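{- Let $R$ be a commutative ring with unity, let $m\ge1$ be an integer, let $\lambda_1,\mu_1:\mathbb N\times\mathbb Z\to R$ have triangular support of order $m$, and put $$f_n(x)=\sum_{b=0}^{w_m(n)}\lambda_1(n,b)\,x^{n-mb},\qquad g_n(x)=\sum_{c=0}^{w_m(n)}\mu_1(n,c)\,x^{n-mc}\qquad(n\in\mathbb N).$$ Assume that there exist families $\lambda_3,\mu_3:\mathbb N\times\mathbb Z\to R$ with triangular support of order $m$ such that, for all $n\in\mathbb N$, $$x^n=\sum_{b=0}^{w_m(n)}\lambda_3(n,b)\,f_{n-mb}(x),\qquad x^n=\sum_{c=0}^{w_m(n)}\mu_3(n,c)\,g_{n-mc}(x).$$ Then, for all $n\in\mathbb N$, $$f_n(x)=\sum_{k=0}^{w_m(n)}g_{n-mk}(x)\,z(n,k),\qquad\text{where}\qquad z(n,k)=\sum_{b=0}^{k}\lambda_1(n,b)\,\mu_3(n-mb,k-b).$$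
   Context: $\mathbb N=\{0,1,2,\dots\}$ and $w_m(n)=\lfloor n/m\rfloor$. A family $\lambda:\mathbb N\times\mathbb Z\to R$ has triangular support of order $m$ if $\lambda(n,k)=0$ whenever $k<0$ or $k>w_m(n)$. -}

module Defs where

open import Algebra.Bundles using (CommutativeRing)
open import Algebra.Bundles.Raw using (RawMonoid)
import Algebra.Definitions.RawMonoid as RawMonoidDefinitions
open import Data.Bool.Base using (if_then_else_)
open import Data.Fin.Base using (toℕ)
open import Data.Integer.Base as ℤ using (ℤ; +_; 0ℤ)
open import Data.Nat.Base as ℕ using (ℕ; zero; suc; _≤_; s≤s; _≡ᵇ_; _⊔_; _∸_; _/_; NonZero)
open import Data.Nat.Properties using (m⊔n≤o⇒m≤o; m⊔n≤o⇒n≤o)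
open import Data.Sum.Base using (_⊎_)
import Level as L

w : (m : ℕ) .{{_ : NonZero m}} → ℕ → ℕ
w m n = n / m

module _ {c ℓ} (M : RawMonoid c ℓ) where

  open RawMonoid M using (Carrier)
  open RawMonoidDefinitions M using (sum)

  -- Both endpoints are included: the indices are 0, 1, …, N.
  sumUpTo : ℕ → (ℕ → Carrier) → Carrier
  sumUpTo N t = sum {suc N} (λ i → t (toℕ i))

module OverRing {c ℓ} (R : CommutativeRing c ℓ) where

  open CommutativeRing R
    using (Carrier; _≈_; _+_; _*_; 0#; 1#; +-rawMonoid; +-cong; +-identityˡ;
           *-congˡ; *-congʳ; zeroˡ; zeroʳ)
    renaming (refl to ≈-refl; trans to ≈-trans)

  Family : Set c
  Family = ℕ → ℤ → Carrier

  TriangularSupport : (m : ℕ) .{{_ : NonZero m}} → Family → Set ℓ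
  TriangularSupport m a =
    ∀ n k → (k ℤ.< 0ℤ) ⊎ (k ℤ.> + (w m n)) → a n k ≈ 0#

  -- R[x]: coefficient sequences that vanish from some index on. The bound need
  -- not be sharp, and _≈ᴾ_ ignores it, so two polynomials are equal exactly when
  -- their coefficients are.
  record Polynomial : Set (c L.⊔ ℓ) where
    field
      coeff    : ℕ → Carrier
      bound    : ℕ
      vanishes : ∀ i → bound ≤ i → coeff i ≈ 0#

  open Polynomial public

  infix  4 _≈ᴾ_
  infixl 6 _+ᴾ_
  infixr 7 _*ₗ_
  infixl 7 _*ᵣ_
  infixr 8 x^_

  _≈ᴾ_ : Polynomial → Polynomial → Set ℓ
  p ≈ᴾ q = ∀ i → coeff p i ≈ coeff q i

  0ᴾ : Polynomial
  0ᴾ = record { coeff = λ _ → 0# ; bound = 0 ; vanishes = λ _ _ → ≈-refl }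

  _+ᴾ_ : Polynomial → Polynomial → Polynomial
  p +ᴾ q = record
    { coeff    = λ i → coeff p i + coeff q i
    ; bound    = bound p ⊔ bound q
    ; vanishes = λ i b≤i → ≈-trans
        (+-cong (vanishes p i (m⊔n≤o⇒m≤o (bound p) (bound q) b≤i))
                (vanishes q i (m⊔n≤o⇒n≤o (bound p) (bound q) b≤i)))
        (+-identityˡ 0#)
    }

  _*ₗ_ : Carrier → Polynomial → Polynomial
  r *ₗ p = record
    { coeff    = λ i → r * coeff p i
    ; bound    = bound p
    ; vanishes = λ i b≤i → ≈-trans (*-congˡ (vanishes p i b≤i)) (zeroʳ r)
    }

  _*ᵣ_ : Polynomial → Carrier → Polynomial
  p *ᵣ r = record
    { coeff    = λ i → coeff p i * r
    ; bound    = bound p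
    ; vanishes = λ i b≤i → ≈-trans (*-congʳ (vanishes p i b≤i)) (zeroˡ r)
    }

  x^_ : ℕ → Polynomial
  x^ n = record
    { coeff    = λ i → if i ≡ᵇ n then 1# else 0#
    ; bound    = suc n
    ; vanishes = vanishes-x^ n
    }
    where
    vanishes-x^ : ∀ n i → suc n ≤ i → (if i ≡ᵇ n then 1# else 0#) ≈ 0#
    vanishes-x^ zero    (suc i) _         = ≈-refl
    vanishes-x^ (suc n) (suc i) (s≤s n<i) = vanishes-x^ n i n<i

  +ᴾ-rawMonoid : RawMonoid (c L.⊔ ℓ) ℓ
  +ᴾ-rawMonoid = record { _≈_ = _≈ᴾ_ ; _∙_ = _+ᴾ_ ; ε = 0ᴾ }

  ∑ : ℕ → (ℕ → Carrier) → Carrier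
  ∑ = sumUpTo +-rawMonoid

  ∑ᴾ : ℕ → (ℕ → Polynomial) → Polynomial
  ∑ᴾ = sumUpTo +ᴾ-rawMonoid

  infixl 10 ∑ ∑ᴾ

  syntax ∑  N (λ k → e) = ∑[ k ≤ N ] e
  syntax ∑ᴾ N (λ k → p) = ∑ᴾ[ k ≤ N ] p

  module _ (m : ℕ) .{{_ : NonZero m}} where

    polynomials : Family → ℕ → Polynomial
    polynomials a n = ∑ᴾ[ b ≤ w m n ] (a n (+ b) *ₗ x^ (n ∸ m ℕ.* b))

    -- Here ∸ is genuine subtraction: b ≤ k, and only k ≤ w m n matter.
    connection : Family → Family → ℕ → ℕ → Carrier
    connection a a′ n k =
      ∑[ b ≤ k ] (a n (+ b) * a′ (n ∸ m ℕ.* b) (+ k ℤ.- + b))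

{-# OPTIONS --safe #-}
-- Substituting the expansion of each x^(n-mb) in the polynomials g into f n gives a
-- sum over pairs (b , c) with b + c ≤ w m n, because w m (n - mb) = w m n - b. The
-- term at (b , c) involves g (n - m(b+c)), so collecting the pairs with b + c = k
-- gives z n k as the coefficient of g (n - mk).
module Submission where

open import Defs
open import Algebra.Bundles using (CommutativeRing)
open import Data.Integer.Base using (+_)
open import Data.Nat.Base using (ℕ; _∸_; _*_; NonZero)

import Algebra.Properties.Semiring.Sum as SemiringSum
open import Data.Fin.Base using (toℕ)
open import Data.Fin.Properties using (toℕ≤pred[n])
open import Data.Integer.Base as ℤ using ()
open import Data.Integer.Properties using (⊖-≥; m-n≡m⊖n)
open import Data.Nat.Base using (zero; suc; _≤_; _+_)
open import Data.Nat.DivMod using (/-congˡ; [m∸n*o]/o≡m/o∸n)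
open import Data.Nat.Properties using (∸-+-assoc; *-comm; *-distribˡ-+; m+[n∸m]≡n)
open import Function.Base using (_∘_)
open import Relation.Binary.PropositionalEquality as ≡ using (_≡_; cong)
import Relation.Binary.Reasoning.Setoid as SetoidReasoning

-- Removing `b` multiples of `m` lowers the quotient by `b`; if `m * b` exceeds `n`, both sides
-- truncate to 0.
w-∸ : ∀ m .{{_ : NonZero m}} n b → w m (n ∸ m * b) ≡ w m n ∸ b
w-∸ m n b = ≡.trans (/-congˡ (cong (n ∸_) (*-comm m b))) ([m∸n*o]/o≡m/o∸n n b m)

∸-*-∸-* : ∀ m n b c → n ∸ m * b ∸ m * c ≡ n ∸ m * (b + c)
∸-*-∸-* m n b c = ≡.trans (∸-+-assoc n (m * b) (m * c)) (cong (n ∸_) (≡.sym (*-distribˡ-+ m b c)))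

-- Bridges the integer index in `connection` and the natural one produced by `∑-triangle`.
+-∸ : ∀ {b k} → b ≤ k → + k ℤ.- + b ≡ + (k ∸ b)
+-∸ {b} {k} b≤k = ≡.trans (m-n≡m⊖n k b) (⊖-≥ b≤k)

module _ {c ℓ} (R : CommutativeRing c ℓ) where

  open OverRing R
  open CommutativeRing R
    renaming (_+_ to _+ᴿ_; _*_ to _*ᴿ_; *-comm to *ᴿ-comm)
    hiding (zero)
  open SemiringSum semiring using (sum-cong-≋; *-distribˡ-sum; *-distribʳ-sum; ∑-distrib-+)
  open SetoidReasoning setoid

  -- The termwise equality receives the bound `k ≤ N` because the index identities in `collect` rely
  -- on it.
  ∑-cong : ∀ N (s t : ℕ → Carrier) → (∀ k → k ≤ N → s k ≈ t k) → ∑ N s ≈ ∑ N t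
  ∑-cong N s t s≈t = sum-cong-≋ {suc N} (λ i → s≈t (toℕ i) (toℕ≤pred[n] i))

  ∑-+ : ∀ N (s t : ℕ → Carrier) → ∑[ k ≤ N ] (s k +ᴿ t k) ≈ ∑ N s +ᴿ ∑ N t
  ∑-+ N s t = ∑-distrib-+ {suc N} (s ∘ toℕ) (t ∘ toℕ)

  ∑-distribˡ : ∀ N r (t : ℕ → Carrier) → r *ᴿ ∑ N t ≈ ∑[ k ≤ N ] (r *ᴿ t k)
  ∑-distribˡ N r t = *-distribˡ-sum {suc N} r (t ∘ toℕ)

  ∑-distribʳ : ∀ N r (t : ℕ → Carrier) → ∑ N t *ᴿ r ≈ ∑[ k ≤ N ] (t k *ᴿ r)
  ∑-distribʳ N r t = *-distribʳ-sum {suc N} r (t ∘ toℕ)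

  -- Polynomial equality is coefficientwise, so this moves the whole argument into the ring at a
  -- fixed degree `i`.
  coeff-∑ᴾ : ∀ N (p : ℕ → Polynomial) i → coeff (∑ᴾ N p) i ≈ ∑[ k ≤ N ] coeff (p k) i
  coeff-∑ᴾ zero    p i = refl
  coeff-∑ᴾ (suc N) p i = +-congˡ (coeff-∑ᴾ N (p ∘ suc) i)

  -- Induction on `N`: peel off the row `b = 0`. The remaining rows form a smaller triangle for
  -- `F ∘ suc`, and each entry of the removed row is the first term of one antidiagonal.
  ∑-triangle : ∀ N (F : ℕ → ℕ → Carrier) →
               ∑[ b ≤ N ] ∑[ c ≤ N ∸ b ] F b c ≈ ∑[ k ≤ N ] ∑[ b ≤ k ] F b (k ∸ b)
  ∑-triangle zero    F = refl
  ∑-triangle (suc N) F = begin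
    (F 0 0 +ᴿ ∑[ c ≤ N ] F 0 (suc c)) +ᴿ ∑[ b ≤ N ] ∑[ c ≤ N ∸ b ] F (suc b) c
      ≈⟨ +-congˡ (∑-triangle N (F ∘ suc)) ⟩
    (F 0 0 +ᴿ ∑[ c ≤ N ] F 0 (suc c)) +ᴿ ∑[ k ≤ N ] ∑[ b ≤ k ] F (suc b) (k ∸ b)
      ≈⟨ +-assoc _ _ _ ⟩
    F 0 0 +ᴿ (∑[ c ≤ N ] F 0 (suc c) +ᴿ ∑[ k ≤ N ] ∑[ b ≤ k ] F (suc b) (k ∸ b))
      -- The antidiagonal `k = 0` unfolds to `F 0 0` plus the empty sum, hence the extra `0#`.
      ≈⟨ +-cong (+-identityʳ _) (∑-+ N (F 0 ∘ suc) (λ k → ∑[ b ≤ k ] F (suc b) (k ∸ b))) ⟨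
    (F 0 0 +ᴿ 0#) +ᴿ ∑[ k ≤ N ] (F 0 (suc k) +ᴿ ∑[ b ≤ k ] F (suc b) (k ∸ b)) ∎

  polynomials-connection :
    ∀ m .{{_ : NonZero m}} (a a′ : Family) (g : ℕ → Polynomial) →
    (∀ n → x^ n ≈ᴾ ∑ᴾ[ k ≤ w m n ] (a′ n (+ k) *ₗ g (n ∸ m * k))) →
    ∀ n → polynomials m a n ≈ᴾ ∑ᴾ[ k ≤ w m n ] (g (n ∸ m * k) *ᵣ connection m a a′ n k)
  polynomials-connection m a a′ g x^≈ n i = begin
    coeff (polynomials m a n) i
      ≈⟨ coeff-∑ᴾ N (λ b → a n (+ b) *ₗ x^ (n ∸ m * b)) i ⟩
    ∑[ b ≤ N ] (a n (+ b) *ᴿ coeff (x^ (n ∸ m * b)) i)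
      ≈⟨ ∑-cong N _ (λ b → ∑[ c ≤ N ∸ b ] F b c) (λ b _ → expand b) ⟩
    ∑[ b ≤ N ] ∑[ c ≤ N ∸ b ] F b c
      ≈⟨ ∑-triangle N F ⟩
    ∑[ k ≤ N ] ∑[ b ≤ k ] F b (k ∸ b)
      ≈⟨ ∑-cong N (λ k → ∑[ b ≤ k ] F b (k ∸ b)) _ (λ k _ → collect k) ⟩
    ∑[ k ≤ N ] (G (n ∸ m * k) *ᴿ connection m a a′ n k)
      ≈⟨ coeff-∑ᴾ N (λ k → g (n ∸ m * k) *ᵣ connection m a a′ n k) i ⟨
    coeff (∑ᴾ[ k ≤ N ] (g (n ∸ m * k) *ᵣ connection m a a′ n k)) i ∎
    where
    N : ℕ
    N = w m n

    G : ℕ → Carrier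
    G j = coeff (g j) i

    -- Contribution of the pair `(b , c)` to the coefficient at `i`. The last factor is written
    -- through `b + c` so that it is visibly constant on antidiagonals.
    F : ℕ → ℕ → Carrier
    F b c = (a n (+ b) *ᴿ a′ (n ∸ m * b) (+ c)) *ᴿ G (n ∸ m * (b + c))

    expand : ∀ b → a n (+ b) *ᴿ coeff (x^ (n ∸ m * b)) i ≈ ∑[ c ≤ N ∸ b ] F b c
    expand b = begin
      a n (+ b) *ᴿ coeff (x^ n′) i
        ≈⟨ *-congˡ (x^≈ n′ i) ⟩
      a n (+ b) *ᴿ coeff (∑ᴾ[ c ≤ w m n′ ] (a′ n′ (+ c) *ₗ g (n′ ∸ m * c))) i
        ≈⟨ *-congˡ (coeff-∑ᴾ (w m n′) (λ c → a′ n′ (+ c) *ₗ g (n′ ∸ m * c)) i) ⟩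
      a n (+ b) *ᴿ ∑[ c ≤ w m n′ ] (a′ n′ (+ c) *ᴿ G (n′ ∸ m * c))
        ≈⟨ ∑-distribˡ (w m n′) (a n (+ b)) (λ c → a′ n′ (+ c) *ᴿ G (n′ ∸ m * c)) ⟩
      ∑[ c ≤ w m n′ ] (a n (+ b) *ᴿ (a′ n′ (+ c) *ᴿ G (n′ ∸ m * c)))
        ≈⟨ ∑-cong (w m n′) (λ c → a n (+ b) *ᴿ (a′ n′ (+ c) *ᴿ G (n′ ∸ m * c))) (F b)
             (λ c _ → trans (sym (*-assoc _ _ _))
             (*-congˡ (reflexive (cong G (∸-*-∸-* m n b c))))) ⟩
      ∑[ c ≤ w m n′ ] F b c
        ≡⟨ cong (λ M → ∑ M (F b)) (w-∸ m n b) ⟩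
      ∑[ c ≤ N ∸ b ] F b c ∎
      where
      n′ : ℕ
      n′ = n ∸ m * b

    -- On the antidiagonal `b + c = k` the factor from `g` is always `G (n ∸ m * k)`, so it can be
    -- pulled out of the sum.
    collect : ∀ k → ∑[ b ≤ k ] F b (k ∸ b) ≈ G (n ∸ m * k) *ᴿ connection m a a′ n k
    collect k = begin
      ∑[ b ≤ k ] F b (k ∸ b)
        ≈⟨ ∑-cong k (λ b → F b (k ∸ b)) (λ b → H b *ᴿ G (n ∸ m * k)) (λ b b≤k → *-cong
             (*-congˡ (reflexive (cong (a′ (n ∸ m * b)) (≡.sym (+-∸ b≤k)))))
             (reflexive (cong (λ j → G (n ∸ m * j)) (m+[n∸m]≡n b≤k)))) ⟩
      ∑[ b ≤ k ] (H b *ᴿ G (n ∸ m * k))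
        -- The sum of `H` over `b ≤ k` is `connection m a a′ n k` by definition.
        ≈⟨ ∑-distribʳ k (G (n ∸ m * k)) H ⟨
      connection m a a′ n k *ᴿ G (n ∸ m * k)
        ≈⟨ *ᴿ-comm _ _ ⟩
      G (n ∸ m * k) *ᴿ connection m a a′ n k ∎
      where
      H : ℕ → Carrier
      H b = a n (+ b) *ᴿ a′ (n ∸ m * b) (+ k ℤ.- + b)

corollary2p8 :
    ∀ {c ℓ} (R : CommutativeRing c ℓ) (m : ℕ) .{{_ : NonZero m}} →
    let open OverRing R in
    (λ₁ μ₁ : Family) → TriangularSupport m λ₁ → TriangularSupport m μ₁ →
    let f = polynomials m λ₁
        g = polynomials m μ₁
    in
    (λ₃ μ₃ : Family) → TriangularSupport m λ₃ → TriangularSupport m μ₃ →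
    (∀ n → x^ n ≈ᴾ ∑ᴾ[ b ≤ w m n ] (λ₃ n (+ b) *ₗ f (n ∸ m * b))) →
    (∀ n → x^ n ≈ᴾ ∑ᴾ[ k ≤ w m n ] (μ₃ n (+ k) *ₗ g (n ∸ m * k))) →
    let z = connection m λ₁ μ₃ in
    ∀ n → f n ≈ᴾ ∑ᴾ[ k ≤ w m n ] (g (n ∸ m * k) *ᵣ z n k)
corollary2p8 R m λ₁ μ₁ _ _ _ μ₃ _ _ _ x^≈g =
  polynomials-connection R m λ₁ μ₃ (OverRing.polynomials R m μ₁) x^≈g
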